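{- For every integer $n \geq 3$, the domination polynomial $D(P_n,x)$ of the path $P_n$ on $n$ vertices is unimodal, and the domination polynomial $D(C_n,x)$ of the cycle $C_n$ on $n$ vertices is unimodal.
   Context: All graphs are finite and undirected (and simple). A subset $S$ of the vertices of a graph $G$ is a dominating set if every vertex of $G$ is either in $S$ or adjacent to a vertex of $S$. Let $d_i(G)$ be the number of dominating sets of $G$ of cardinality $i$. The domination polynomial of $G$ is $D(G,x)=\sum_{i} d_i(G)x^i$, where $0\le i\le |V(G)|$ (coefficients below the domination number are $0$). A real polynomial $a_0+a_1x+\cdots+a_nx^n$ is unimodal if there is $0\le k\le n$ with $a_0\le a_1\le\cdots\le a_k\ge a_{k+1}\ge\cdots\ge a_n$. -}

module Defs where

open import Data.Fin.Base using (Fin; zero; suc; toℕ; inject₁)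
open import Data.Fin.Properties using (any?; all?)
open import Data.Fin.Subset using (Subset; inside; outside; _∈_; ∣_∣)
open import Data.Fin.Subset.Properties using (_∈?_)
open import Data.List.Base using (List; []; _∷_; _++_; map; filter; length)
open import Data.Nat.Base using (ℕ; zero; suc; _≤_; _<_; _≥_; s≤s)
open import Data.Nat.Properties using (_≟_; 1+n≢n)
open import Data.Product.Base using (∃; ∃-syntax; _×_; _,_)
open import Data.Sum.Base using (_⊎_; inj₁; inj₂; swap)
open import Data.Vec.Base as Vec using (Vec)
open import Data.Vec.Functional using (Vector)
open import Level using (0ℓ)
open import Relation.Binary.Core using (Rel)
open import Relation.Binary.Definitions using (Decidable; Irreflexive; Symmetric)
open import Relation.Binary.PropositionalEquality using (_≡_; refl; sym; trans; cong)
open import Relation.Nullary using (¬_; Dec; _×-dec_; _⊎-dec_)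

-- Decidability of adjacency holds automatically for finite graphs classically;
-- constructively it is what makes dominating sets countable.
record Graph (n : ℕ) : Set₁ where
  field
    Adj     : Rel (Fin n) 0ℓ
    symm    : Symmetric Adj
    irrefl  : Irreflexive _≡_ Adj
    adj?    : Decidable Adj

Dominating : ∀ {n} → Graph n → Subset n → Set
Dominating G S = ∀ v → v ∈ S ⊎ (∃[ u ] (u ∈ S × Graph.Adj G v u))

dominating? : ∀ {n} (G : Graph n) (S : Subset n) → Dec (Dominating G S)
dominating? G S =
  all? λ v → (v ∈? S) ⊎-dec any? λ u → (u ∈? S) ×-dec Graph.adj? G v u

-- Every subset of Fin n, listed exactly once.
subsets : ∀ n → List (Subset n)
subsets zero    = Vec.[] ∷ []
subsets (suc n) =
  map (inside Vec.∷_) (subsets n) ++ map (outside Vec.∷_) (subsets n)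

d : ∀ {n} → Graph n → ℕ → ℕ
d {n} G i =
  length (filter (λ S → dominating? G S ×-dec (∣ S ∣ ≟ i)) (subsets n))

-- A polynomial a₀ + a₁x + ⋯ + aₙxⁿ is given by its coefficients a₀, …, aₙ.
-- Natural-number coefficients suffice for domination polynomials, and the
-- order on ℕ is the one inherited from ℝ.
Polynomial : ℕ → Set
Polynomial n = Vector ℕ (suc n)

domPoly : ∀ {n} → Graph n → Polynomial n
domPoly G i = d G (toℕ i)

-- For i : Fin n, the entries a (inject₁ i) and a (suc i) are aᵢ and aᵢ₊₁.
Unimodal : ∀ {n} → Polynomial n → Set
Unimodal {n} a = ∃ λ (k : Fin (suc n)) →
  (∀ (i : Fin n) → toℕ i < toℕ k → a (inject₁ i) ≤ a (suc i)) ×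
  (∀ (i : Fin n) → toℕ k ≤ toℕ i → a (inject₁ i) ≥ a (suc i))

path : ∀ n → Graph n
path n = record
  { Adj    = λ i j → Next i j ⊎ Next j i
  ; symm   = swap
  ; irrefl = λ { refl (inj₁ e) → 1+n≢n e ; refl (inj₂ e) → 1+n≢n e }
  ; adj?   = λ i j → next? i j ⊎-dec next? j i
  }
  where
  Next : Rel (Fin n) 0ℓ
  Next i j = suc (toℕ i) ≡ toℕ j

  next? : Decidable Next
  next? i j = suc (toℕ i) ≟ toℕ j

-- The second alternative of Next closes the cycle: n - 1 is followed by 0.
cycle : ∀ n → n ≥ 3 → Graph n
cycle n n≥3 = record
  { Adj    = λ i j → Next i j ⊎ Next j i
  ; symm   = swap
  ; irrefl = λ { refl (inj₁ e) → ¬loop n≥3 e ; refl (inj₂ e) → ¬loop n≥3 e }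
  ; adj?   = λ i j → next? i j ⊎-dec next? j i
  }
  where
  Next : Rel (Fin n) 0ℓ
  Next i j = suc (toℕ i) ≡ toℕ j ⊎ (suc (toℕ i) ≡ n × toℕ j ≡ 0)

  next? : Decidable Next
  next? i j = (suc (toℕ i) ≟ toℕ j) ⊎-dec ((suc (toℕ i) ≟ n) ×-dec (toℕ j ≟ 0))

  ¬loop : n ≥ 3 → ∀ {i} → ¬ Next i i
  ¬loop _ (inj₁ e) = 1+n≢n e
  ¬loop h (inj₂ (e , z)) with trans (sym e) (cong suc z)
  ¬loop (s≤s ()) (inj₂ (e , z)) | refl

{-# OPTIONS --safe #-}

-- A dominating set of size k in Pₙ or Cₙ leaves gaps of at most two vertices
-- between consecutive chosen vertices, so the polynomials of both families
-- satisfy fₙ₊₃ = x (fₙ₊₂ + fₙ₊₁ + fₙ).  Subtracting two instances gives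
-- fₙ₊₄ = fₙ₊₃ + x (fₙ₊₃ - fₙ).  If fₙ, …, fₙ₊₃ are unimodal with nondecreasing
-- modes, then the first form shows that fₙ₊₄ rises where fₙ₊₁ still rises and
-- falls from m + 1 on, where m is the mode of fₙ₊₃; the second shows that it
-- rises where fₙ falls but fₙ₊₃ rises.  So fₙ₊₄ has mode m or m + 1.
module Submission where

open import Defs
open import Data.Bool.Base using (Bool; true; false; T; _∧_; _∨_)
open import Data.Bool.Properties using (T-∧; T-∨; T-≡; ∨-identityʳ)
open import Data.Empty using (⊥-elim)
open import Data.Fin.Base using (Fin; zero; suc; toℕ; fromℕ<; inject₁)
open import Data.Fin.Properties using (toℕ-fromℕ<; toℕ-inject₁; toℕ<n; ∀-cons-⇔)
open import Data.Fin.Subset using (Subset; inside; outside; _∈_; ∣_∣)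
open import Data.List.Base using ([]; _∷_; _++_; map; filter; length)
open import Data.List.Properties using (filter-++; filter-none; length-++)
open import Data.List.Relation.Unary.All as All using ()
open import Data.Nat.Base
open import Data.Nat.Properties
open import Data.Nat.Tactic.RingSolver using (solve-∀)
open import Data.Product.Base using (∃; ∃-syntax; _×_; _,_; proj₁; proj₂)
open import Data.Product.Function.NonDependent.Propositional using (_×-⇔_)
open import Data.Sum.Base using (_⊎_; inj₁; inj₂)
open import Data.Sum.Function.Propositional using (_⊎-⇔_)
open import Data.Vec.Base using ([]; _∷_; lookup; there)
open import Data.Vec.Properties using ([]=⇒lookup; lookup⇒[]=)
open import Function.Base using (_∘_)
open import Function.Bundles using (_⇔_; mk⇔; Equivalence)
open import Function.Construct.Composition using (_⇔-∘_)
open import Function.Construct.Identity using (⇔-id)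
open import Function.Construct.Symmetry using (⇔-sym)
open import Relation.Binary.PropositionalEquality
open import Relation.Nullary using (does; yes; no; _×-dec_; _→-dec_)
open import Relation.Nullary.Decidable using (True; toWitness)
open import Relation.Unary using (Decidable)

open Equivalence using (to; from)

-- Unimodal sequences of polynomials

-- Multiplication by x. Polynomials are coefficient sequences on all of ℕ, so sums and recurrences
-- carry no degree bounds.
shift : (ℕ → ℕ) → ℕ → ℕ
shift f zero    = 0
shift f (suc k) = f k

shift-cong : ∀ {f g} → f ≗ g → shift f ≗ shift g
shift-cong f≗g zero    = refl
shift-cong f≗g (suc k) = f≗g k

Recurrent : (ℕ → ℕ → ℕ) → Set
Recurrent f = ∀ n → f (3 + n) ≗ shift λ k → f (2 + n) k + f (1 + n) k + f n k

recurrent-cong : ∀ {f g} → (∀ n → f n ≗ g n) → Recurrent f → Recurrent g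
recurrent-cong f≗g rec n k = trans (sym (f≗g (3 + n) k)) (trans (rec n k)
  (shift-cong (λ j → cong₂ _+_ (cong₂ _+_ (f≗g (2 + n) j) (f≗g (1 + n) j)) (f≗g n j)) k))

recurrent-shift : ∀ f → Recurrent f → Recurrent (λ n → shift (f n))
recurrent-shift f rec n zero          = refl
recurrent-shift f rec n (suc zero)    = rec n zero
recurrent-shift f rec n (suc (suc k)) = rec n (suc k)

recurrent-+ : ∀ f g → Recurrent f → Recurrent g → Recurrent (λ n k → f n k + g n k)
recurrent-+ f g f-rec g-rec n zero = cong₂ _+_ (f-rec n zero) (g-rec n zero)
recurrent-+ f g f-rec g-rec n (suc k) =
  trans (cong₂ _+_ (f-rec n (suc k)) (g-rec n (suc k)))
    (interchange (f (2 + n) k) (f (1 + n) k) (f n k) (g (2 + n) k) (g (1 + n) k) (g n k))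
  where
  interchange : ∀ a b c a′ b′ c′ →
    (a + b + c) + (a′ + b′ + c′) ≡ (a + a′) + (b + b′) + (c + c′)
  interchange = solve-∀

IsMode : (ℕ → ℕ) → ℕ → Set
IsMode f m = (∀ k → k < m → f k ≤ f (suc k)) × (∀ k → m ≤ k → f (suc k) ≤ f k)

-- Beyond index `N` all coefficients vanish, so computation decides the comparisons below `m + N`
-- and the later ones are trivial.
isMode-byInspection : ∀ {f} N m → (∀ k → f (suc (N + k)) ≡ 0) →
  {True (allUpTo? (λ k → (k <? m →-dec f k ≤? f (suc k)) ×-dec
                         (m ≤? k →-dec f (suc k) ≤? f k)) (m + N))} →
  IsMode f m
isMode-byInspection {f} N m vanishes {ok} =
  (λ k k<m → proj₁ (toWitness ok (<-≤-trans k<m (m≤m+n m N))) k<m) , falls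
  where
  falls : ∀ k → m ≤ k → f (suc k) ≤ f k
  falls k m≤k with k <? m + N
  ... | yes k<m+N = proj₂ (toWitness ok k<m+N) m≤k
  ... | no  k≮m+N = subst (_≤ f k) (sym fk+1≡0) z≤n
    where
    fk+1≡0 : f (suc k) ≡ 0
    fk+1≡0 = subst (λ j → f (suc j) ≡ 0)
      (m+[n∸m]≡n (≤-trans (m≤n+m N m) (≮⇒≥ k≮m+N))) (vanishes (k ∸ N))

-- A window of four: the recurrence reaches back three polynomials, its subtracted form four.
record MonotoneModes (f : ℕ → ℕ → ℕ) (n : ℕ) : Set where
  constructor monotoneModes
  field
    {m₀ m₁ m₂ m₃} : ℕ
    mode₀ : IsMode (f n) m₀
    mode₁ : IsMode (f (1 + n)) m₁
    mode₂ : IsMode (f (2 + n)) m₂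
    mode₃ : IsMode (f (3 + n)) m₃
    m₀≤m₁ : m₀ ≤ m₁
    m₁≤m₂ : m₁ ≤ m₂
    m₂≤m₃ : m₂ ≤ m₃

module _ {f : ℕ → ℕ → ℕ} (rec : Recurrent f) where

  module _ {n : ℕ} (modes : MonotoneModes f n) where
    open MonotoneModes modes

    next-rises : ∀ k → k < m₃ → f (4 + n) k ≤ f (4 + n) (suc k)
    next-rises zero    _      = subst (_≤ f (4 + n) 1) (sym (rec (1 + n) 0)) z≤n
    next-rises (suc k) k+1<m₃ with k <? m₁
    ... | yes k<m₁ rewrite rec (1 + n) (suc k) | rec (1 + n) (2 + k) =
      +-mono-≤ (+-mono-≤ (proj₁ mode₃ k (<-trans (n<1+n k) k+1<m₃))
                         (proj₁ mode₂ k (<-≤-trans k<m₁ m₁≤m₂)))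
               (proj₁ mode₁ k k<m₁)
    -- Past the mode of `f n`, adding `f n (suc k)` to both sides lets the recurrence fold three
    -- summands on each side into one coefficient of `f (3 + n)`, which still rises.
    ... | no  k≮m₁ rewrite rec (1 + n) (suc k) | rec (1 + n) (2 + k) =
      +-cancelʳ-≤ (f n (suc k)) _ _ (begin
        f (3 + n) k + f (2 + n) k + f (1 + n) k + f n (suc k)
          ≤⟨ +-monoʳ-≤ _ (proj₂ mode₀ k (≤-trans m₀≤m₁ (≮⇒≥ k≮m₁))) ⟩
        f (3 + n) k + f (2 + n) k + f (1 + n) k + f n k
          ≡⟨ regroup (f (3 + n) k) (f (2 + n) k) (f (1 + n) k) (f n k) ⟩
        f (3 + n) k + (f (2 + n) k + f (1 + n) k + f n k)
          ≡⟨ cong (f (3 + n) k +_) (rec n (suc k)) ⟨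
        f (3 + n) k + f (3 + n) (suc k)
          ≤⟨ +-mono-≤ (proj₁ mode₃ k (<-trans (n<1+n k) k+1<m₃)) (proj₁ mode₃ (suc k) k+1<m₃) ⟩
        f (3 + n) (suc k) + f (3 + n) (2 + k)
          ≡⟨ cong (f (3 + n) (suc k) +_) (rec n (2 + k)) ⟩
        f (3 + n) (suc k) + (f (2 + n) (suc k) + f (1 + n) (suc k) + f n (suc k))
          ≡⟨ regroup (f (3 + n) (suc k)) (f (2 + n) (suc k)) (f (1 + n) (suc k)) (f n (suc k)) ⟨
        f (3 + n) (suc k) + f (2 + n) (suc k) + f (1 + n) (suc k) + f n (suc k) ∎)
      where
      open ≤-Reasoning
      regroup : ∀ a b c e → a + b + c + e ≡ a + (b + c + e)
      regroup = solve-∀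

    -- The factor x moves every fall up by one index, hence the strict bound.
    next-falls : ∀ k → m₃ < k → f (4 + n) (suc k) ≤ f (4 + n) k
    next-falls (suc k) (s≤s m₃≤k) rewrite rec (1 + n) (suc k) | rec (1 + n) (2 + k) =
      +-mono-≤ (+-mono-≤ (proj₂ mode₃ k m₃≤k)
                         (proj₂ mode₂ k (≤-trans m₂≤m₃ m₃≤k)))
               (proj₂ mode₁ k (≤-trans m₁≤m₂ (≤-trans m₂≤m₃ m₃≤k)))

    -- Only the comparison of the coefficients at `m₃` and `suc m₃` is left open; its outcome
    -- decides which of the two is the mode.
    next-mode : ∃[ m ] (m₃ ≤ m × IsMode (f (4 + n)) m)
    next-mode with ≤-total (f (4 + n) (suc m₃)) (f (4 + n) m₃)
    ... | inj₁ fall = m₃ , ≤-refl , next-rises , falls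
      where
      falls : ∀ k → m₃ ≤ k → f (4 + n) (suc k) ≤ f (4 + n) k
      falls k m₃≤k with m≤n⇒m<n∨m≡n m₃≤k
      ... | inj₁ m₃<k = next-falls k m₃<k
      ... | inj₂ refl = fall
    ... | inj₂ rise = suc m₃ , n≤1+n m₃ , rises , next-falls
      where
      rises : ∀ k → k < suc m₃ → f (4 + n) k ≤ f (4 + n) (suc k)
      rises k (s≤s k≤m₃) with m≤n⇒m<n∨m≡n k≤m₃
      ... | inj₁ k<m₃ = next-rises k k<m₃
      ... | inj₂ refl = rise

    next-modes : MonotoneModes f (1 + n)
    next-modes =
      let _ , m₃≤m , mode = next-mode
      in monotoneModes mode₁ mode₂ mode₃ mode m₁≤m₂ m₂≤m₃ m₃≤m

  all-modes : MonotoneModes f 0 → ∀ n → MonotoneModes f n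
  all-modes init zero    = init
  all-modes init (suc n) = next-modes (all-modes init n)

  recurrent⇒mode : MonotoneModes f 0 → ∀ n → ∃ (IsMode (f n))
  recurrent⇒mode init n = _ , MonotoneModes.mode₀ (all-modes init n)

-- A mode of the sequence on ℕ may exceed `n`, so it is capped there; no `i : Fin n` lies at or past
-- an effective cap.
mode⇒unimodal : ∀ {n} {p : Polynomial n} {f} → (∀ i → p i ≡ f (toℕ i)) →
  ∃ (IsMode f) → Unimodal p
mode⇒unimodal {n} {p} {f} p≡f (m , rises , falls) = k ,
  (λ i i<k → subst₂ _≤_ (sym (p-inject₁ i)) (sym (p≡f (suc i)))
    (rises (toℕ i) (<-≤-trans (subst (toℕ i <_) k≡m⊓n i<k) (m⊓n≤m m n)))) ,
  (λ i k≤i → subst₂ _≤_ (sym (p≡f (suc i))) (sym (p-inject₁ i))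
    (falls (toℕ i) (m≤i i (subst (_≤ toℕ i) k≡m⊓n k≤i))))
  where
  m⊓n<1+n : m ⊓ n < suc n
  m⊓n<1+n = s≤s (m⊓n≤n m n)

  k : Fin (suc n)
  k = fromℕ< m⊓n<1+n

  k≡m⊓n : toℕ k ≡ m ⊓ n
  k≡m⊓n = toℕ-fromℕ< m⊓n<1+n

  p-inject₁ : ∀ i → p (inject₁ i) ≡ f (toℕ i)
  p-inject₁ i = trans (p≡f (inject₁ i)) (cong f (toℕ-inject₁ i))

  m≤i : ∀ (i : Fin n) → m ⊓ n ≤ toℕ i → m ≤ toℕ i
  m≤i i m⊓n≤i with ≤-total m n
  ... | inj₁ m≤n = subst (_≤ toℕ i) (m≤n⇒m⊓n≡m m≤n) m⊓n≤i
  ... | inj₂ n≤m = ⊥-elim (<⇒≱ (toℕ<n i) (subst (_≤ toℕ i) (m≥n⇒m⊓n≡n n≤m) m⊓n≤i))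

-- Counting subsets by size

constant : Bool → ℕ → ℕ
constant true  zero    = 1
constant false zero    = 0
constant _     (suc _) = 0

-- The generating polynomial, by size, of the subsets satisfying `p`; a chosen first vertex
-- contributes a factor x.
tally : ∀ n → (Subset n → Bool) → ℕ → ℕ
tally zero    p k = constant (p []) k
tally (suc n) p k = shift (tally n (p ∘ (inside ∷_))) k + tally n (p ∘ (outside ∷_)) k

tally-false : ∀ n k → tally n (λ _ → false) k ≡ 0
tally-false zero    zero    = refl
tally-false zero    (suc k) = refl
tally-false (suc n) zero    = tally-false n zero
tally-false (suc n) (suc k) = cong₂ _+_ (tally-false n k) (tally-false n (suc k))

length-filter-map : ∀ {A B : Set} {P : B → Set} (P? : Decidable P) (h : A → B) xs →
  length (filter P? (map h xs)) ≡ length (filter (P? ∘ h) xs)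
length-filter-map P? h []       = refl
length-filter-map P? h (x ∷ xs) with does (P? (h x))
... | true  = cong suc (length-filter-map P? h xs)
... | false = length-filter-map P? h xs

length-filter≡tally : ∀ n {P : Subset n → Set} (P? : Decidable P) (p : Subset n → Bool) k →
  (∀ S → P S ⇔ (T (p S) × ∣ S ∣ ≡ k)) → length (filter P? (subsets n)) ≡ tally n p k
length-filter≡tally zero P? p k P⇔ with P? [] | p [] | k | P⇔ []
... | yes _ | true  | zero  | _ = refl
... | no ¬P | true  | zero  | e = ⊥-elim (¬P (from e (_ , refl)))
... | yes P | false | zero  | e = ⊥-elim (proj₁ (to e P))
... | no _  | false | zero  | _ = refl
... | no _  | true  | suc _ | _ = refl
... | no _  | false | suc _ | _ = refl
... | yes P | _     | suc _ | e with () ← proj₂ (to e P)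
length-filter≡tally (suc n) {P} P? p k P⇔ = begin
  length (filter P? (map (inside ∷_) (subsets n) ++ map (outside ∷_) (subsets n)))
    ≡⟨ cong length (filter-++ P? (map (inside ∷_) (subsets n)) _) ⟩
  length (filter P? (map (inside ∷_) (subsets n)) ++ filter P? (map (outside ∷_) (subsets n)))
    ≡⟨ length-++ (filter P? (map (inside ∷_) (subsets n))) ⟩
  length (filter P? (map (inside ∷_) (subsets n))) +
  length (filter P? (map (outside ∷_) (subsets n)))
    ≡⟨ cong₂ _+_ (trans (length-filter-map P? (inside ∷_) (subsets n)) (insides k P⇔))
         (trans (length-filter-map P? (outside ∷_) (subsets n))
           (length-filter≡tally n (P? ∘ (outside ∷_)) (p ∘ (outside ∷_)) k (P⇔ ∘ (outside ∷_)))) ⟩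
  tally (suc n) p k ∎
  where
  open ≡-Reasoning
  insides : ∀ k → (∀ S → P S ⇔ (T (p S) × ∣ S ∣ ≡ k)) →
    length (filter (P? ∘ (inside ∷_)) (subsets n)) ≡ shift (tally n (p ∘ (inside ∷_))) k
  insides zero    P⇔ = cong length (filter-none (P? ∘ (inside ∷_))
    (All.universal (λ S PS → 1+n≢0 (proj₂ (to (P⇔ (inside ∷ S)) PS))) (subsets n)))
  insides (suc k) P⇔ = length-filter≡tally n (P? ∘ (inside ∷_)) (p ∘ (inside ∷_)) k
    λ S → (⇔-id _ ×-⇔ mk⇔ suc-injective (cong suc)) ⇔-∘ P⇔ (inside ∷ S)

d≡tally : ∀ {n} (G : Graph n) p → (∀ S → Dominating G S ⇔ T (p S)) →
  ∀ k → d G k ≡ tally n p k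
d≡tally {n} G p dom⇔ k =
  length-filter≡tally n (λ S → dominating? G S ×-dec (∣ S ∣ ≟ k)) p k λ S → dom⇔ S ×-⇔ ⇔-id _

-- Scanning a subset from left to right

-- The state of the last vertex read; a pending vertex still needs its right
-- neighbour.
data Status : Set where
  chosen dominated pending : Status

-- A finite automaton. `F` leaves the end condition open, because the cases of a cycle differ from
-- each other and from a path there.
accept : ∀ {n} → (Status → Bool) → Status → Subset n → Bool
accept F s         []            = F s
accept F s         (inside  ∷ S) = accept F chosen S
accept F chosen    (outside ∷ S) = accept F dominated S
accept F dominated (outside ∷ S) = accept F pending S
accept F pending   (outside ∷ S) = false

-- The next chosen vertex follows after a gap of zero, one or two, which gives the three terms; a
-- third unchosen vertex is rejected and contributes zero.
accept-chosen-recurrent : ∀ F → Recurrent (λ n → tally n (accept F chosen))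
accept-chosen-recurrent F n zero    = tally-false n 0
accept-chosen-recurrent F n (suc k) = trans
  (cong (λ z → a (2 + n) + (a (1 + n) + (a n + z))) (tally-false n (suc k)))
  (regroup (a (2 + n)) (a (1 + n)) (a n))
  where
  a : ℕ → ℕ
  a m = tally m (accept F chosen) k

  regroup : ∀ a b c → a + (b + (c + 0)) ≡ a + b + c
  regroup = solve-∀

-- The state of a vertex with membership x whose left neighbour has membership b.
status : Bool → Bool → Status
status b     true  = chosen
status true  false = dominated
status false false = pending

-- Reading `y` settles the preceding vertex, whose closed neighbourhood has memberships `b`, `x` and
-- `y`.
accept-status : ∀ {n} F b x y (S : Subset n) →
  accept F (status b x) (y ∷ S) ≡ (b ∨ x ∨ y) ∧ accept F (status x y) S
accept-status F true  true  true  S = refl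
accept-status F false true  true  S = refl
accept-status F true  false true  S = refl
accept-status F false false true  S = refl
accept-status F true  true  false S = refl
accept-status F false true  false S = refl
accept-status F true  false false S = refl
accept-status F false false false S = refl

-- The acceptance condition when a virtual vertex of membership c follows the
-- last one.
final : Bool → Status → Bool
final true  _       = true
final false pending = false
final false _       = true

final-status : ∀ b x c → final c (status b x) ≡ b ∨ x ∨ c
final-status true  true  true  = refl
final-status false true  true  = refl
final-status true  false true  = refl
final-status false false true  = refl
final-status true  true  false = refl
final-status false true  false = refl
final-status true  false false = refl
final-status false false false = refl

-- Memberships of the neighbours of v in S, when virtual vertices of
-- memberships b and c are placed before the first and after the last vertex.
left : ∀ {n} → Bool → Subset n → Fin n → Bool
left b (x ∷ S) zero    = b
left b (x ∷ S) (suc v) = left x S v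

right : ∀ {n} → Subset n → Bool → Fin n → Bool
right (x ∷ [])    c zero    = c
right (x ∷ y ∷ S) c zero    = y
right (x ∷ S)     c (suc v) = right S c v

Covered : ∀ {n} → Bool → Subset n → Bool → Set
Covered b S c = ∀ v → T (left b S v ∨ lookup S v ∨ right S c v)

-- Each step splits off the condition at the first vertex, which then acts as the virtual left
-- neighbour of the rest; `final` tests the last condition.
covered⇔accept : ∀ {n} b x (S : Subset n) c →
  Covered b (x ∷ S) c ⇔ T (accept (final c) (status b x) S)
covered⇔accept b x [] c rewrite final-status b x c =
  mk⇔ (λ cov → cov zero) λ { t zero → t }
covered⇔accept b x (y ∷ S) c rewrite accept-status (final c) b x y S =
  ⇔-sym T-∧ ⇔-∘ ((⇔-id _ ×-⇔ covered⇔accept x y S c) ⇔-∘ ⇔-sym ∀-cons-⇔)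

∈⇔lookup : ∀ {n} {S : Subset n} {v} → v ∈ S ⇔ T (lookup S v)
∈⇔lookup {S = S} {v} = mk⇔ (from T-≡ ∘ []=⇒lookup) (lookup⇒[]= v S ∘ to T-≡)

left⇔ : ∀ {n} b (S : Subset n) v →
  T (left b S v) ⇔ ((∃[ u ] (u ∈ S × suc (toℕ u) ≡ toℕ v)) ⊎ (toℕ v ≡ 0 × T b))
left⇔ b (x ∷ S) zero = mk⇔ (λ t → inj₂ (refl , t)) λ { (inj₁ (_ , _ , ())) ; (inj₂ (_ , t)) → t }
left⇔ b (x ∷ S) (suc v) = mk⇔ (λ t → inj₁ (into (to (left⇔ x S v) t)))
  λ { (inj₁ p) → from (left⇔ x S v) (out p) ; (inj₂ (() , _)) }
  where
  into : (∃[ u ] (u ∈ S × suc (toℕ u) ≡ toℕ v)) ⊎ (toℕ v ≡ 0 × T x) →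
    ∃[ u ] (u ∈ x ∷ S × suc (toℕ u) ≡ suc (toℕ v))
  into (inj₁ (u , u∈S , e)) = suc u , there u∈S , cong suc e
  into (inj₂ (v≡0 , t))     = zero , from ∈⇔lookup t , cong suc (sym v≡0)

  out : ∃[ u ] (u ∈ x ∷ S × suc (toℕ u) ≡ suc (toℕ v)) →
    (∃[ u ] (u ∈ S × suc (toℕ u) ≡ toℕ v)) ⊎ (toℕ v ≡ 0 × T x)
  out (zero  , z∈S       , e) = inj₂ (sym (suc-injective e) , to ∈⇔lookup z∈S)
  out (suc u , there u∈S , e) = inj₁ (u , u∈S , suc-injective e)

right⇔ : ∀ {n} (S : Subset n) c v →
  T (right S c v) ⇔ ((∃[ u ] (u ∈ S × suc (toℕ v) ≡ toℕ u)) ⊎ (suc (toℕ v) ≡ n × T c))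
right⇔ (x ∷ []) c zero = mk⇔ (λ t → inj₂ (refl , t))
  λ { (inj₁ (zero , _ , ())) ; (inj₂ (_ , t)) → t }
right⇔ (x ∷ y ∷ S) c zero = mk⇔ (λ t → inj₁ (suc zero , there (from ∈⇔lookup t) , refl))
  λ { (inj₁ (suc zero , there y∈S , _)) → to ∈⇔lookup y∈S }
right⇔ (x ∷ S@(_ ∷ _)) c (suc v) = mk⇔ (into ∘ to (right⇔ S c v)) (from (right⇔ S c v) ∘ out)
  where
  into : (∃[ u ] (u ∈ S × suc (toℕ v) ≡ toℕ u)) ⊎ (suc (toℕ v) ≡ _ × T c) →
    (∃[ u ] (u ∈ x ∷ S × suc (suc (toℕ v)) ≡ toℕ u)) ⊎ (suc (suc (toℕ v)) ≡ _ × T c)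
  into (inj₁ (u , u∈S , e)) = inj₁ (suc u , there u∈S , cong suc e)
  into (inj₂ (e , t))       = inj₂ (cong suc e , t)

  out : (∃[ u ] (u ∈ x ∷ S × suc (suc (toℕ v)) ≡ toℕ u)) ⊎ (suc (suc (toℕ v)) ≡ _ × T c) →
    (∃[ u ] (u ∈ S × suc (toℕ v) ≡ toℕ u)) ⊎ (suc (toℕ v) ≡ _ × T c)
  out (inj₁ (suc u , there u∈S , e)) = inj₁ (u , u∈S , suc-injective e)
  out (inj₂ (e , t))                 = inj₂ (suc-injective e , t)

-- Serves both families: only the virtual memberships and the check `adj⇔` depend on the graph.
dominating⇔covered : ∀ {n} (G : Graph n) b (S : Subset n) c →
  (∀ v → (∃[ u ] (u ∈ S × Graph.Adj G v u)) ⇔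
    (((∃[ u ] (u ∈ S × suc (toℕ u) ≡ toℕ v)) ⊎ (toℕ v ≡ 0 × T b)) ⊎
     ((∃[ u ] (u ∈ S × suc (toℕ v) ≡ toℕ u)) ⊎ (suc (toℕ v) ≡ n × T c)))) →
  Dominating G S ⇔ Covered b S c
dominating⇔covered G b S c adj⇔ =
  mk⇔ (λ dom v → to (vertex v) (dom v)) (λ cov v → from (vertex v) (cov v))
  where
  rotate : ∀ {A B C : Set} → (A ⊎ (B ⊎ C)) ⇔ (B ⊎ (A ⊎ C))
  rotate = mk⇔ exchange exchange
    where
    exchange : ∀ {A B C : Set} → A ⊎ (B ⊎ C) → B ⊎ (A ⊎ C)
    exchange (inj₁ a)        = inj₂ (inj₁ a)
    exchange (inj₂ (inj₁ b)) = inj₁ b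
    exchange (inj₂ (inj₂ c)) = inj₂ (inj₂ c)

  vertex : ∀ v → (v ∈ S ⊎ (∃[ u ] (u ∈ S × Graph.Adj G v u))) ⇔
                 T (left b S v ∨ lookup S v ∨ right S c v)
  vertex v = ⇔-sym T-∨ ⇔-∘ ((⇔-id _ ⊎-⇔ ⇔-sym T-∨) ⇔-∘ (rotate ⇔-∘
    (∈⇔lookup ⊎-⇔ ((⇔-sym (left⇔ b S v) ⊎-⇔ ⇔-sym (right⇔ S c v)) ⇔-∘ adj⇔ v))))

-- Paths

path-dominating⇔accept : ∀ {n} (S : Subset (suc n)) →
  Dominating (path (suc n)) S ⇔ T (accept (final false) dominated S)
path-dominating⇔accept {n} (x ∷ S) = scan x ⇔-∘ (covered⇔accept false x S false ⇔-∘
  dominating⇔covered (path (suc n)) false (x ∷ S) false λ v → mk⇔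
    (λ { (u , u∈ , inj₁ e) → inj₂ (inj₁ (u , u∈ , e))
       ; (u , u∈ , inj₂ e) → inj₁ (inj₁ (u , u∈ , e)) })
    (λ { (inj₂ (inj₁ (u , u∈ , e))) → u , u∈ , inj₁ e
       ; (inj₁ (inj₁ (u , u∈ , e))) → u , u∈ , inj₂ e }))
  where
  -- The start state `dominated` stands for an unchosen virtual vertex that needs no neighbour.
  scan : ∀ x → T (accept (final false) (status false x) S) ⇔
               T (accept (final false) dominated (x ∷ S))
  scan true  = ⇔-id _
  scan false = ⇔-id _

pathCount : ℕ → ℕ → ℕ
pathCount n = tally (2 + n) (accept (final false) dominated)

-- The first chosen vertex is the first or the second one, so each count is a sum of two shifted
-- counts from the state `chosen`.
pathCount-recurrent : Recurrent pathCount
pathCount-recurrent = recurrent-cong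
  (λ n k → cong (shift (a (1 + n)) k +_)
    (trans (sym (+-identityʳ _)) (cong (shift (a n) k +_) (sym (tally-false n k)))))
  (recurrent-+ (λ n → shift (a (1 + n))) (λ n → shift (a n))
    (recurrent-shift (λ n → a (1 + n)) (λ n → a-rec (1 + n))) (recurrent-shift a a-rec))
  where
  a : ℕ → ℕ → ℕ
  a n = tally n (accept (final false) chosen)

  a-rec : Recurrent a
  a-rec = accept-chosen-recurrent (final false)

pathCount-mode : ∀ n → ∃ (IsMode (pathCount n))
pathCount-mode = recurrent⇒mode pathCount-recurrent (monotoneModes
  -- The initial window is P₂, ..., P₅, each with its degree and mode.
  (isMode-byInspection 2 1 (λ _ → refl))
  (isMode-byInspection 3 2 (λ _ → refl))
  (isMode-byInspection 4 2 (λ _ → refl))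
  (isMode-byInspection 5 3 (λ _ → refl))
  (n≤1+n 1) ≤-refl (n≤1+n 2))

-- Cycles

lastOr : ∀ {n} → Bool → Subset n → Bool
lastOr x []      = x
lastOr x (y ∷ S) = lastOr y S

lastOr⇔ : ∀ {n} x (S : Subset n) → T (lastOr x S) ⇔ (∃[ u ] (u ∈ x ∷ S × toℕ u ≡ n))
lastOr⇔ x [] = mk⇔ (λ t → zero , from ∈⇔lookup t , refl) λ { (zero , u∈ , _) → to ∈⇔lookup u∈ }
lastOr⇔ x (y ∷ S) = mk⇔
  (λ t → let u , u∈ , e = to (lastOr⇔ y S) t in suc u , there u∈ , cong suc e)
  λ { (suc u , there u∈ , e) → from (lastOr⇔ y S) (u , u∈ , suc-injective e) }

-- Around the cycle the last vertex precedes the first, so these two supply the virtual memberships.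
cycle-dominating⇔covered : ∀ {n} (n≥3 : suc n ≥ 3) x (S : Subset n) →
  Dominating (cycle (suc n) n≥3) (x ∷ S) ⇔ Covered (lastOr x S) (x ∷ S) x
cycle-dominating⇔covered {n} n≥3 x S = dominating⇔covered (cycle (suc n) n≥3) (lastOr x S) (x ∷ S) x
  λ v → mk⇔
    (λ { (u , u∈ , inj₁ (inj₁ e))          → inj₂ (inj₁ (u , u∈ , e))
       ; (zero , u∈ , inj₁ (inj₂ (e , _))) → inj₂ (inj₂ (e , to ∈⇔lookup u∈))
       ; (u , u∈ , inj₂ (inj₁ e))          → inj₁ (inj₁ (u , u∈ , e))
       ; (u , u∈ , inj₂ (inj₂ (e , v≡0)))  →
           inj₁ (inj₂ (v≡0 , from (lastOr⇔ x S) (u , u∈ , suc-injective e))) })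
    (λ { (inj₂ (inj₁ (u , u∈ , e))) → u , u∈ , inj₁ (inj₁ e)
       ; (inj₂ (inj₂ (e , t)))      → zero , from ∈⇔lookup t , inj₁ (inj₂ (e , refl))
       ; (inj₁ (inj₁ (u , u∈ , e))) → u , u∈ , inj₂ (inj₁ e)
       ; (inj₁ (inj₂ (v≡0 , t)))    →
           let u , u∈ , e = to (lastOr⇔ x S) t in u , u∈ , inj₂ (inj₂ (cong suc e , v≡0)) })

isChosen : Status → Bool
isChosen chosen = true
isChosen _      = false

-- `final false` accepts `chosen`, so also requiring the last vertex to be chosen amounts to the
-- stricter end condition `isChosen`.
accept-lastOr : ∀ {n} b x (S : Subset n) →
  lastOr x S ∧ accept (final false) (status b x) S ≡ accept isChosen (status b x) S
accept-lastOr true  true  []      = refl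
accept-lastOr false true  []      = refl
accept-lastOr true  false []      = refl
accept-lastOr false false []      = refl
accept-lastOr b     x     (y ∷ S)
  rewrite accept-status (final false) b x y S | accept-status isChosen b x y S
  with b ∨ x ∨ y
... | true  = accept-lastOr x y S
... | false with lastOr y S
...   | true  = refl
...   | false = refl

-- If the first two vertices are not chosen, the last vertex has to be.
acceptCycle : ∀ {n} → Subset (2 + n) → Bool
acceptCycle (inside  ∷ S)           = accept (final true) chosen S
acceptCycle (outside ∷ inside  ∷ S) = accept (final false) chosen S
acceptCycle (outside ∷ outside ∷ S) = accept isChosen pending S

-- A chosen first or second vertex covers the first one. Otherwise the last vertex must cover it,
-- and `accept-lastOr` moves this demand to the end of the scan.
cycle-accept : ∀ {n} x (S : Subset (suc n)) →
  accept (final x) (status (lastOr x S) x) S ≡ acceptCycle (x ∷ S)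
cycle-accept true  S             = refl
cycle-accept false (true  ∷ S)   = refl
cycle-accept false (false ∷ S)   =
  trans (accept-status (final false) (lastOr false S) false false S)
    (trans (cong (_∧ accept (final false) pending S) (∨-identityʳ (lastOr false S)))
      (accept-lastOr false false S))

cycle-dominating⇔accept : ∀ {n} (n≥3 : 2 + n ≥ 3) (S : Subset (2 + n)) →
  Dominating (cycle (2 + n) n≥3) S ⇔ T (acceptCycle S)
cycle-dominating⇔accept n≥3 (x ∷ S) rewrite sym (cycle-accept x S) =
  covered⇔accept (lastOr x S) x S x ⇔-∘ cycle-dominating⇔covered n≥3 x S

cycleCount : ℕ → ℕ → ℕ
cycleCount n = tally (3 + n) acceptCycle

-- The first chosen vertex is the first, second or third; each case is a shifted count from the
-- state `chosen` with its own end condition.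
cycleCount-recurrent : Recurrent cycleCount
cycleCount-recurrent = recurrent-cong
  (λ n k → cong (λ z → shift (a (final true) (2 + n)) k + (shift (a (final false) (1 + n)) k + z))
    (trans (sym (+-identityʳ _)) (cong (shift (a isChosen n) k +_) (sym (tally-false n k)))))
  (recurrent-+ f (λ n k → g n k + h n k)
    (recurrent-shift (λ n → a (final true) (2 + n)) (λ n → a-rec (final true) (2 + n)))
    (recurrent-+ g h
      (recurrent-shift (λ n → a (final false) (1 + n)) (λ n → a-rec (final false) (1 + n)))
      (recurrent-shift (a isChosen) (a-rec isChosen))))
  where
  a : (Status → Bool) → ℕ → ℕ → ℕ
  a F n = tally n (accept F chosen)

  a-rec : ∀ F → Recurrent (a F)
  a-rec = accept-chosen-recurrent

  f g h : ℕ → ℕ → ℕ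
  f n = shift (a (final true) (2 + n))
  g n = shift (a (final false) (1 + n))
  h n = shift (a isChosen n)

cycleCount-mode : ∀ n → ∃ (IsMode (cycleCount n))
cycleCount-mode = recurrent⇒mode cycleCount-recurrent (monotoneModes
  (isMode-byInspection 3 2 (λ _ → refl))
  (isMode-byInspection 4 2 (λ _ → refl))
  (isMode-byInspection 5 3 (λ _ → refl))
  (isMode-byInspection 6 4 (λ _ → refl))
  ≤-refl (n≤1+n 2) (n≤1+n 3))

corollary2p3 : (n : ℕ) (n≥3 : n ≥ 3) → Unimodal (domPoly (path n)) × Unimodal (domPoly (cycle n n≥3))
corollary2p3 (suc (suc (suc n))) n≥3@(s≤s (s≤s (s≤s z≤n))) =
  -- `pathCount` starts at P₂ and `cycleCount` at C₃, hence the indices `1 + n` and `n`.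
  mode⇒unimodal (λ i → d≡tally (path (3 + n)) _ path-dominating⇔accept (toℕ i))
    (pathCount-mode (1 + n)) ,
  mode⇒unimodal (λ i → d≡tally (cycle (3 + n) n≥3) _ (cycle-dominating⇔accept n≥3) (toℕ i))
    (cycleCount-mode n)
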